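{- Let $D$ be an infinite, connected, edge transitive, weakly descendant-homogeneous digraph of finite out-valency $m>1$ with property $Z$. Suppose that every alternet of $D$ is isomorphic to a fixed bipartite digraph $\Sigma\in\mathcal{C}$. Then $D$ is highly-arc-transitive.
   Context: Digraphs have no loops; subdigraphs are induced. An $s$-arc ($s\ge0$) from $u$ to $v$ is a sequence $u_0\dots u_s$ with $u_0=u$, $u_s=v$, $(u_i,u_{i+1})$ edges, and $u_{i-1}\ne u_{i+1}$ for $0<i<s$; $\mathrm{desc}(u)$ is the set of endpoints of arcs from $u$, $\mathrm{desc}(X)=\bigcup_{x\in X}\mathrm{desc}(x)$. Highly-arc-transitive: $\mathrm{Aut}(D)$ is transitive on $s$-arcs for every $s\ge0$. Edge transitive: $\mathrm{Aut}(D)$ transitive on edges. Weakly descendant-homogeneous: vertex transitive, and for finite vertex sets $X,Y$ and any isomorphism $f$ between the induced subdigraphs on $\mathrm{desc}(X)$, $\mathrm{desc}(Y)$ there is an automorphism agreeing with $f$ on $X$. Property $Z$: there is a surjection $f$ from vertices onto $\mathbb{Z}$ with $f(v)=f(u)+1$ for each edge $(u,v)$. Alternating walk: $x_0\dots x_n$ such that either $(x_{2i-1},x_{2i})$ and $(x_{2i+1},x_{2i})$ are edges for all relevant $i$, or $(x_{2i},x_{2i-1})$ and $(x_{2i},x_{2i+1})$ are edges for all relevant $i$. Edge $e$ reaches $e'$ if some alternating walk $x_0\dots x_n$ has $e=(x_0,x_1)$, $e'\in\{(x_{n-1},x_n),(x_n,x_{n-1})\}$. An alternet is the subdigraph spanned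 by an equivalence class of this relation; its sources/sinks are the tails/heads of its edges. $\delta(u,v)$ iff $u,v$ have the same set of out-neighbours. Class $\mathcal{C}$: bipartite digraphs with parts $X$ (sources), $Y$ (sinks), all edges from $X$ to $Y$, no isolated vertices, $X,Y$ finite non-empty, edge transitive, $\delta$ non-trivial on $X$, and $|Y|$ equal to the size of the $\delta$-classes in $X$. -}

module Defs where

open import Data.Nat using (ℕ; zero; suc; _<_; _≤_; pred)
open import Data.Nat.Properties using ()
open import Data.Integer using (ℤ) renaming (_+_ to _+ℤ_; 1ℤ to oneℤ)
open import Data.Bool using (Bool; true; false; not; _xor_)
open import Data.Fin using (Fin)
open import Data.List using (List)
open import Data.List.Membership.Propositional using (_∈_)
open import Data.Product using (Σ; ∃; ∃-syntax; _×_; _,_)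
open import Data.Sum using (_⊎_)
open import Data.Unit using (⊤)
open import Data.Empty using (⊥)
open import Relation.Nullary using (¬_)
open import Relation.Binary.PropositionalEquality using (_≡_; _≢_; refl)
open import Function.Bundles using (_↔_; _⇔_; Inverse)

record Digraph : Set₁ where
  field
    V      : Set
    E      : V → V → Set
    E-prop : ∀ {u v} (p q : E u v) → p ≡ q
    loopless : ∀ v → ¬ E v v

module _ (D : Digraph) where
  open Digraph D

  record Aut : Set where
    field
      bij  : V ↔ V
    open Inverse bij public using (to; from)
    field
      pres : ∀ u v → E u v ⇔ E (to u) (to v)

  -- s-arcs, an arc being given by u : ℕ → V (only u 0 … u s matter)
  IsArc : ℕ → (ℕ → V) → Set
  IsArc s u = (∀ i → i < s → E (u i) (u (suc i)))
            × (∀ i → suc i < s → u i ≢ u (suc (suc i)))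

  HighlyArcTransitive : Set
  HighlyArcTransitive = ∀ s (u w : ℕ → V) → IsArc s u → IsArc s w →
    Σ Aut λ g → ∀ i → i ≤ s → Aut.to g (u i) ≡ w i

  VertexTransitive : Set
  VertexTransitive = ∀ u v → Σ Aut λ g → Aut.to g u ≡ v

  EdgeTransitive : Set
  EdgeTransitive = ∀ u v u' v' → E u v → E u' v' →
    Σ Aut λ g → (Aut.to g u ≡ u') × (Aut.to g v ≡ v')

  Infinite : Set
  Infinite = ¬ (Σ (List V) λ l → ∀ v → v ∈ l)

  data UWalk : V → V → Set where
    here : ∀ {v} → UWalk v v
    fwd  : ∀ {u v w} → E u v → UWalk v w → UWalk u w
    bwd  : ∀ {u v w} → E v u → UWalk v w → UWalk u w

  Connected : Set
  Connected = ∀ u v → UWalk u v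

  OutValency : ℕ → Set
  OutValency m = ∀ u → Σ V (E u) ↔ Fin m

  PropertyZ : Set
  PropertyZ = Σ (V → ℤ) λ f → (∀ z → ∃[ v ] f v ≡ z)
                           × (∀ u v → E u v → f v ≡ f u +ℤ oneℤ)

  Desc : V → V → Set
  Desc x w = Σ ℕ λ s → Σ (ℕ → V) λ u → IsArc s u × (u 0 ≡ x) × (u s ≡ w)

  DescL : List V → V → Set
  DescL X w = Σ V λ x → (x ∈ X) × Desc x w

  self-desc : ∀ (X : List V) x → x ∈ X → DescL X x
  self-desc X x m = x , m , 0 , (λ _ → x) , ((λ i ()) , (λ i ())) , refl , refl

  Step : Bool → V → V → Set
  Step true  x y = E x y
  Step false x y = E y x

  -- Reaches u v u' v' : edge (u,v) reaches edge (u',v') by an alternating walk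
  -- x 0 … x n (n ≥ 1);  b = true: even-indexed vertices are tails,
  -- b = false: odd-indexed vertices are tails.
  Reaches : V → V → V → V → Set
  Reaches u v u' v' = Σ ℕ λ n → Σ (ℕ → V) λ x → Σ Bool λ b →
      (1 ≤ n)
    × (∀ i → i < n → Step (b xor odd i) (x i) (x (suc i)))
    × (x 0 ≡ u) × (x 1 ≡ v)
    × (((x (pred n) ≡ u') × (x n ≡ v')) ⊎ ((x n ≡ u') × (x (pred n) ≡ v')))
    where
    odd : ℕ → Bool
    odd zero = false
    odd (suc k) = not (odd k)

  AlternetV : V → V → V → Set
  AlternetV a b w = Σ V λ c → Σ V λ d → E c d × Reaches a b c d × ((w ≡ c) ⊎ (w ≡ d))

  δ : V → V → Set
  δ u v = ∀ w → E u w ⇔ E v w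

  IsSource IsSink : V → Set
  IsSource x = Σ V λ y → E x y
  IsSink   y = Σ V λ x → E x y

-- Bijections between (not necessarily propositional) predicates,
-- independent of the membership witnesses.

record PredBij {A B : Set} (P : A → Set) (Q : B → Set) : Set where
  field
    fun  : ∀ a → P a → B
    irr  : ∀ a (p q : P a) → fun a p ≡ fun a q
    into : ∀ a (p : P a) → Q (fun a p)
    inj  : ∀ a a' (p : P a) (p' : P a') → fun a p ≡ fun a' p' → a ≡ a'
    surj : ∀ b → Q b → Σ A λ a → Σ (P a) λ p → fun a p ≡ b

record SubIso (D : Digraph) (P : Digraph.V D → Set)
              (D' : Digraph) (Q : Digraph.V D' → Set) : Set where
  field
    bij  : PredBij P Q
  open PredBij bij public
  field
    pres : ∀ a a' (p : P a) (p' : P a') →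
           Digraph.E D a a' ⇔ Digraph.E D' (fun a p) (fun a' p')

WeaklyDescendantHomogeneous : Digraph → Set
WeaklyDescendantHomogeneous D =
  VertexTransitive D ×
  (∀ (X Y : List (Digraph.V D)) (f : SubIso D (DescL D X) D (DescL D Y)) →
     Σ (Aut D) λ g → ∀ x (m : x ∈ X) →
       Aut.to g x ≡ SubIso.fun f x (self-desc D X x m))

record InClassC (S : Digraph) : Set where
  open Digraph S
  field
    size    : ℕ
    finite  : V ↔ Fin size
    -- bipartite: every vertex is a source (of the bipartition) or a sink,
    -- not both; hence all edges go from X to Y and there are no isolated vertices
    parts   : ∀ v → (IsSource S v × ¬ IsSink S v) ⊎ (IsSink S v × ¬ IsSource S v)
    nonempty : Σ V (IsSource S)
    edgeTrans : EdgeTransitive S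
    δ-nontrivial : Σ V λ x → Σ V λ x' → IsSource S x × IsSource S x' × x ≢ x' × δ S x x'
    δ-classes : ∀ x → IsSource S x → PredBij (λ x' → IsSource S x' × δ S x x') (IsSink S)

-- The out-neighbours of a vertex u all have the same out-neighbours.  Let y be a sink of an
-- alternet A and K its δ-class.  For k ∈ K other than y and for a sink z ≠ y, k of A, exchanging
-- y for k and fixing everything else is an isomorphism desc{y,z} → desc{k,z}, so some automorphism
-- maps y to k and fixes z, hence A.  Thus K lies inside the sinks of A, and |K| = |Y| gives
-- equality.  Consequently, if h maps (u₀,u₁) to (w₀,w₁) and g maps (u₁,…,uₛ) to (w₁,…,wₛ), then
-- using h on the first two levels of desc(u₀) and g below them gives an isomorphism
-- desc(u₀) → desc(w₀), and s-arc transitivity follows by induction on s.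
--
-- Constructively, equality of vertices has to be decidable for the case distinctions above; it is,
-- because connectedness provides a walk to every vertex and a walk can be coded by a word.
module Submission where

open import Defs
open import Algebra.Properties.Group using (∙-cancelˡ; ∙-cancelʳ)
open import Algebra.Bundles using (AbelianGroup)
open import Data.Bool using (true)
open import Data.Fin using (Fin; zero; suc)
open import Data.Fin.Properties using (any?; pigeonhole; <-irrefl) renaming (_≟_ to _≟F_)
open import Data.Integer using (ℤ; +_; 0ℤ) renaming (_+_ to _+ℤ_; 1ℤ to oneℤ)
open import Data.Integer.Properties using (+-0-abelianGroup; +-injective)
  renaming (+-assoc to +ℤ-assoc; +-identityʳ to +ℤ-identityʳ)
open import Data.List using (List; []; _∷_; applyUpTo)
open import Data.List.Membership.Propositional using (_∈_)
open import Data.List.Membership.Propositional.Properties using (∈-applyUpTo⁺; ∈-applyUpTo⁻)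
open import Data.List.Properties using (∷-injectiveˡ; ∷-injectiveʳ; ≡-dec)
open import Data.List.Relation.Unary.Any using () renaming (here to hereₗ; there to thereₗ)
open import Data.Nat using (ℕ; zero; suc; _<_; _≤_; z≤n; s≤s; z<s; s≤s⁻¹) renaming (_+_ to _+ℕ_)
open import Data.Nat.Properties using (n<1+n; <-trans; <-≤-trans)
  renaming (_≟_ to _≟ℕ_; +-comm to +ℕ-comm)
open import Data.Product using (Σ; ∃-syntax; _×_; _,_; proj₁; proj₂)
open import Data.Sum using (_⊎_; inj₁; inj₂; [_,_]′)
open import Data.Sum.Properties using (inj₁-injective; inj₂-injective) renaming (≡-dec to ⊎-≡-dec)
open import Data.Unit using (⊤; tt)
open import Function.Base using (_∘_)
open import Function.Bundles using (_↔_; _⇔_; Inverse; Equivalence; mk⇔)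
open import Function.Construct.Identity using (↔-id; ⇔-id)
open import Function.Construct.Symmetry using (⇔-sym; ↔-sym)
open import Function.Construct.Composition using (_⇔-∘_)
open import Relation.Binary.Definitions using (DecidableEquality)
open import Relation.Binary.PropositionalEquality
open import Relation.Nullary using (¬_; Dec; yes; no; contradiction)
open import Relation.Nullary.Decidable using (map′)

-- Cancellation in the integers and finite sets.

ℤ-cancelˡ : ∀ x {y z : ℤ} → x +ℤ y ≡ x +ℤ z → y ≡ z
ℤ-cancelˡ x = ∙-cancelˡ (AbelianGroup.group +-0-abelianGroup) x _ _

ℤ-cancelʳ : ∀ x {y z : ℤ} → y +ℤ x ≡ z +ℤ x → y ≡ z
ℤ-cancelʳ x = ∙-cancelʳ (AbelianGroup.group +-0-abelianGroup) x _ _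

↔-injective : {A B : Set} (f : A ↔ B) → ∀ {x y} → Inverse.to f x ≡ Inverse.to f y → x ≡ y
↔-injective f {x} {y} eq = trans (sym (Inverse.strictlyInverseʳ f x))
  (trans (cong (Inverse.from f) eq) (Inverse.strictlyInverseʳ f y))

-- Extended by the identity outside `P`, `θ` becomes an injection of the whole finite set, because
-- its values stay inside `P`; the decision procedure is what makes this extension definable.
finite-injective⇒onto :
  {S : Set} {n : ℕ} → S ↔ Fin n → {P : S → Set} → (∀ t → Dec (P t)) →
  (θ : ∀ t → P t → S) → (∀ t p → P (θ t p)) →
  (∀ t t' p p' → θ t p ≡ θ t' p' → t ≡ t') →
  ∀ t → P t → Σ S λ t' → Σ (P t') λ p' → θ t' p' ≡ t
finite-injective⇒onto {S} {n} fin {P} P? θ θ-P θ-inj t pt = onto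
  where
  open Inverse fin

  φ : ∀ s → Dec (P s) → S
  φ s (yes p) = θ s p
  φ s (no _)  = s

  φ-inj : ∀ s s' (d : Dec (P s)) (d' : Dec (P s')) → φ s d ≡ φ s' d' → s ≡ s'
  φ-inj s s' (yes p) (yes p') eq = θ-inj s s' p p' eq
  φ-inj s s' (yes p) (no ¬p') eq = contradiction (subst P eq (θ-P s p)) ¬p'
  φ-inj s s' (no ¬p) (yes p') eq = contradiction (subst P (sym eq) (θ-P s' p')) ¬p
  φ-inj s s' (no _)  (no _)   eq = eq

  h : Fin n → Fin n
  h i = to (φ (from i) (P? (from i)))

  h-inj : ∀ {i j} → h i ≡ h j → i ≡ j
  h-inj eq = ↔-injective (↔-sym fin) (φ-inj _ _ (P? _) (P? _) (↔-injective fin eq))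

  hit : ∀ s (d : Dec (P s)) → φ s d ≡ t → Σ S λ t' → Σ (P t') λ p' → θ t' p' ≡ t
  hit s (yes p) eq = s , p , eq
  hit s (no ¬p) eq = contradiction (subst P (sym eq) pt) ¬p

  onto : Σ S λ t' → Σ (P t') λ p' → θ t' p' ≡ t
  onto with any? (λ i → h i ≟F to t)
  ... | yes (i , eq) = hit (from i) (P? (from i)) (↔-injective fin eq)
  -- The extra pigeon `zero` sits on the missed value, so a collision contradicts either the miss or
  -- the injectivity of `h`.
  ... | no missed with pigeonhole (n<1+n n) (λ { zero → to t ; (suc i) → h i })
  ...   | zero  , suc j , _       , eq = contradiction (j , sym eq) missed
  ...   | suc i , suc j , s≤s i<j , eq = contradiction i<j (<-irrefl (h-inj eq))

-- Automorphisms, alternets and directed paths.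

module _ {D : Digraph} where
  open Digraph D

  E⇒E-to : (g : Aut D) → ∀ {u v} → E u v → E (Aut.to g u) (Aut.to g v)
  E⇒E-to g = Equivalence.to (Aut.pres g _ _)

  Aut-inverse : Aut D → Aut D
  Aut-inverse g = record
    { bij  = ↔-sym (Aut.bij g)
    ; pres = λ u v → ⇔-sym (subst₂ (λ a b → E _ _ ⇔ E a b)
        (Inverse.strictlyInverseˡ (Aut.bij g) u) (Inverse.strictlyInverseˡ (Aut.bij g) v)
        (Aut.pres g _ _)) }

  δ-sym : ∀ {x y} → δ D x y → δ D y x
  δ-sym d w = ⇔-sym (d w)

  -- Alternating walks may backtrack: `a b a z c d` runs along the given edge twice, so that it can
  -- leave `a` again towards `z`.
  reaches : ∀ {a b c d z} → E a b → E a z → E c z → E c d → Reaches D a b c d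
  reaches {a} {b} {c} {d} {z} ab az cz cd = 5 , x , true , s≤s z≤n , steps , refl , refl , inj₁ (refl , refl)
    where
    x : ℕ → V
    x 0 = a
    x 1 = b
    x 2 = a
    x 3 = z
    x 4 = c
    x (suc (suc (suc (suc (suc _))))) = d

    steps : ∀ i → i < 5 → _
    steps 0 _ = ab
    steps 1 _ = ab
    steps 2 _ = az
    steps 3 _ = cz
    steps 4 _ = cd
    steps (suc (suc (suc (suc (suc i))))) (s≤s (s≤s (s≤s (s≤s (s≤s ())))))

  alternet-source : ∀ {a b c z} → E a b → E a z → E c z → AlternetV D a b c
  alternet-source {c = c} {z} ab az cz = c , z , cz , reaches ab az cz cz , inj₁ refl

  alternet-sink : ∀ {a b c d z} → E a b → E a z → E c z → E c d → AlternetV D a b d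
  alternet-sink {c = c} {d} ab az cz cd = c , d , cd , reaches ab az cz cd , inj₂ refl

  -- Unlike an arc, a path carries no condition against returning, so it can be concatenated and
  -- rerouted freely; under property Z that condition is automatic.
  data Path : ℕ → V → V → Set where
    []  : ∀ {x} → Path 0 x x
    _∷_ : ∀ {n x y a} → E x y → Path n y a → Path (suc n) x a

  _++_ : ∀ {m n x y a} → Path m x y → Path n y a → Path (m +ℕ n) x a
  []      ++ q = q
  (e ∷ p) ++ q = e ∷ (p ++ q)

  Path-map : (g : Aut D) → ∀ {n x a} → Path n x a → Path n (Aut.to g x) (Aut.to g a)
  Path-map g []      = []
  Path-map g (e ∷ p) = E⇒E-to g e ∷ Path-map g p

  walk⇒Path : ∀ n (u : ℕ → V) → (∀ i → i < n → E (u i) (u (suc i))) → Path n (u 0) (u n)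
  walk⇒Path zero    u e = []
  walk⇒Path (suc n) u e = e 0 z<s ∷ walk⇒Path n (u ∘ suc) (λ i i<n → e (suc i) (s≤s i<n))

  Path⇒walk : ∀ {n x a} → Path n x a →
    Σ (ℕ → V) λ u → (∀ i → i < n → E (u i) (u (suc i))) × (u 0 ≡ x) × (u n ≡ a)
  Path⇒walk {x = x} [] = (λ _ → x) , (λ i ()) , refl , refl
  Path⇒walk {x = x} (e ∷ p) with Path⇒walk p
  ... | u , es , refl , eq = u' , es' , refl , eq
    where
    u' : ℕ → V
    u' zero    = x
    u' (suc i) = u i

    es' : ∀ i → i < suc _ → E (u' i) (u' (suc i))
    es' zero    _         = e
    es' (suc i) (s≤s i<n) = es i i<n

  Desc⇒Path : ∀ {x a} → Desc D x a → ∃[ n ] Path n x a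
  Desc⇒Path (s , u , (es , _) , refl , refl) = s , walk⇒Path s u es

-- The level structure given by property Z.

module Levels {D : Digraph} (pz : PropertyZ D) where
  open Digraph D

  ℓ : V → ℤ
  ℓ = proj₁ pz

  ℓ-edge : ∀ {u v} → E u v → ℓ v ≡ ℓ u +ℤ oneℤ
  ℓ-edge = proj₂ (proj₂ pz) _ _

  ℓ-siblings : ∀ {u y z} → E u y → E u z → ℓ y ≡ ℓ z
  ℓ-siblings e e' = trans (ℓ-edge e) (sym (ℓ-edge e'))

  ℓ-coparents : ∀ {x x' y} → E x y → E x' y → ℓ x ≡ ℓ x'
  ℓ-coparents e e' = ℤ-cancelʳ oneℤ (trans (sym (ℓ-edge e)) (ℓ-edge e'))

  ℓ-Path : ∀ {n x a} → Path {D} n x a → ℓ a ≡ ℓ x +ℤ + n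
  ℓ-Path []                        = sym (+ℤ-identityʳ _)
  ℓ-Path {suc n} {x} (e ∷ p) = trans (ℓ-Path p)
    (trans (cong (_+ℤ + n) (ℓ-edge e)) (+ℤ-assoc (ℓ x) oneℤ (+ n)))

  -- Two consecutive edges raise the level by 2, so no vertex of a path equals the next but one.
  Path⇒Desc : ∀ {n x a} → Path {D} n x a → Desc D x a
  Path⇒Desc {n} p with Path⇒walk p
  ... | u , es , u0 , un = n , u , (es , no-return) , u0 , un
    where
    no-return : ∀ i → suc i < n → u i ≢ u (suc (suc i))
    no-return i i<n eq = 0≢2 (+-injective (ℤ-cancelˡ (ℓ (u i)) (begin
      ℓ (u i) +ℤ + 0        ≡⟨ +ℤ-identityʳ _ ⟩
      ℓ (u i)               ≡⟨ cong ℓ eq ⟩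
      ℓ (u (suc (suc i)))   ≡⟨ ℓ-Path (es i (<-trans (n<1+n i) i<n) ∷ (es (suc i) i<n ∷ [])) ⟩
      ℓ (u i) +ℤ + 2        ∎)))
      where
      open ≡-Reasoning
      0≢2 : ¬ (0 ≡ 2)
      0≢2 ()

  -- Levels make the depth of a vertex unique and let edges join only consecutive depths. Hence an
  -- isomorphism may be given depth by depth, by maps `F n` that are bijective at each depth and
  -- respect edges from depth `n` to depth `suc n`. Here `lG` and `lH` are the levels of depth 0.
  module GradedIso
    {P Q : V → Set} {G H : ℕ → V → Set} {lG lH : ℤ}
    (P⇒G : ∀ {a} → P a → ∃[ n ] G n a) (G⇒P : ∀ {n a} → G n a → P a)
    (Q⇒H : ∀ {b} → Q b → ∃[ n ] H n b) (H⇒Q : ∀ {n b} → H n b → Q b)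
    (ℓ-G : ∀ {n a} → G n a → ℓ a ≡ lG +ℤ + n) (ℓ-H : ∀ {n b} → H n b → ℓ b ≡ lH +ℤ + n)
    (F : ℕ → V → V)
    (F-into : ∀ n {a} → G n a → H n (F n a))
    (F-inj  : ∀ n {a a'} → G n a → G n a' → F n a ≡ F n a' → a ≡ a')
    (F-surj : ∀ n {b} → H n b → Σ V λ a → G n a × F n a ≡ b)
    (F-edge : ∀ n {a a'} → G n a → G (suc n) a' → E a a' ⇔ E (F n a) (F (suc n) a'))
    where

    depth-unique : ∀ (K : ℕ → V → Set) l → (∀ {n a} → K n a → ℓ a ≡ l +ℤ + n) →
                   ∀ {a n n'} → K n a → K n' a → n ≡ n'
    depth-unique K l ℓ-K k k' = +-injective (ℤ-cancelˡ l (trans (sym (ℓ-K k)) (ℓ-K k')))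

    depth-edge : ∀ (K : ℕ → V → Set) l → (∀ {n a} → K n a → ℓ a ≡ l +ℤ + n) →
                 ∀ {a a' n n'} → K n a → K n' a' → E a a' → n' ≡ suc n
    depth-edge K l ℓ-K {n = n} {n'} k k' e = trans (+-injective (ℤ-cancelˡ l (begin
      l +ℤ + n'            ≡⟨ sym (ℓ-K k') ⟩
      ℓ _                  ≡⟨ ℓ-edge e ⟩
      ℓ _ +ℤ oneℤ          ≡⟨ cong (_+ℤ oneℤ) (ℓ-K k) ⟩
      (l +ℤ + n) +ℤ oneℤ   ≡⟨ +ℤ-assoc l (+ n) oneℤ ⟩
      l +ℤ + (n +ℕ 1)      ∎))) (+ℕ-comm n 1)
      where open ≡-Reasoning

    fun : ∀ a → P a → V
    fun a p = F (proj₁ (P⇒G p)) a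

    fun-at : ∀ {n a} (p : P a) → G n a → fun a p ≡ F n a
    fun-at {a = a} p g = cong (λ n → F n a) (depth-unique G lG ℓ-G (proj₂ (P⇒G p)) g)

    edge : ∀ {n n' a a'} → G n a → G n' a' → E a a' ⇔ E (F n a) (F n' a')
    edge {n} {n'} g g' with n' ≟ℕ suc n
    ... | yes refl = F-edge n g g'
    -- At depths that are not consecutive there is no edge on either side.
    ... | no apart = mk⇔ (λ e → contradiction (depth-edge G lG ℓ-G g g' e) apart)
                         (λ e → contradiction (depth-edge H lH ℓ-H (F-into n g) (F-into n' g') e) apart)

    inj : ∀ {n n' a a'} → G n a → G n' a' → F n a ≡ F n' a' → a ≡ a'
    inj {n} {n'} g g' eq with depth-unique H lH ℓ-H (F-into n g) (subst (H n') (sym eq) (F-into n' g'))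
    ... | refl = F-inj n g g' eq

    iso : SubIso D P D Q
    iso = record
      { bij = record
        { fun  = fun
        ; irr  = λ a p q → fun-at p (proj₂ (P⇒G q))
        ; into = λ a p → H⇒Q (F-into _ (proj₂ (P⇒G p)))
        ; inj  = λ a a' p p' → inj (proj₂ (P⇒G p)) (proj₂ (P⇒G p'))
        ; surj = surj }
      ; pres = λ a a' p p' → edge (proj₂ (P⇒G p)) (proj₂ (P⇒G p')) }
      where
      surj : ∀ b → Q b → Σ V λ a → Σ (P a) λ p → fun a p ≡ b
      surj b q with Q⇒H q
      ... | n , hb with F-surj n hb
      ...   | a , ga , eq = a , G⇒P ga , trans (fun-at (G⇒P ga) ga) eq

-- Neighbours and decidable equality of vertices.

module _ (D : Digraph) (m : ℕ) (Σ' : Digraph)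
         (connected : Connected D) (et : EdgeTransitive D)
         (wdh : WeaklyDescendantHomogeneous D)
         (ov : OutValency D m) (1<m : 1 < m) (pz : PropertyZ D)
         (inC : InClassC Σ')
         (alt : ∀ a b → Digraph.E D a b → SubIso D (AlternetV D a b) Σ' (λ _ → ⊤)) where

  open Digraph D
  open Levels {D} pz
  open InClassC inC
  private module S = Digraph Σ'

  other-index : ∀ {n} → 1 < n → (i : Fin n) → Σ (Fin n) λ j → j ≢ i
  other-index (s≤s (s≤s _)) zero    = suc zero , λ ()
  other-index (s≤s (s≤s _)) (suc i) = zero , λ ()

  out-neighbour : ∀ u → Σ V (E u)
  out-neighbour u = Inverse.from (ov u) (first 1<m)
    where
    first : ∀ {n} → 1 < n → Fin n
    first (s≤s _) = zero

  other-out-neighbour : ∀ {u y} → E u y → Σ V λ z → E u z × z ≢ y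
  other-out-neighbour {u} {y} e with other-index 1<m (Inverse.to (ov u) (y , e))
  ... | j , j≢i = proj₁ (from j) , proj₂ (from j) , λ eq → j≢i (begin
      j              ≡⟨ sym (strictlyInverseˡ j) ⟩
      to (from j)    ≡⟨ cong to (Σ-≡ eq) ⟩
      to (y , e)     ∎)
    where
    open Inverse (ov u)
    open ≡-Reasoning
    Σ-≡ : ∀ {z} {e' : E u z} → z ≡ y → (z , e') ≡ (y , e)
    Σ-≡ {e' = e'} refl = cong (y ,_) (E-prop e' e)

  -- Vertex transitivity carries the head of some edge to `u`.
  in-neighbour : ∀ u → Σ V λ v → E v u
  in-neighbour u with out-neighbour (proj₁ (proj₁ (proj₂ pz) 0ℤ))
  ... | o , e with proj₁ wdh o u
  ...   | g , refl = _ , E⇒E-to g e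

  Letter : Set
  Letter = Fin m ⊎ Fin size

  in-alternet : ∀ u → SubIso D (AlternetV D (proj₁ (in-neighbour u)) u) Σ' (λ _ → ⊤)
  in-alternet u = alt _ u (proj₂ (in-neighbour u))

  co-source : ∀ {u v} → E v u → AlternetV D (proj₁ (in-neighbour u)) u v
  co-source {u} e = alternet-source (proj₂ (in-neighbour u)) (proj₂ (in-neighbour u)) e

  -- In-valency is not assumed finite, but all in-neighbours of `u` lie in one alternet, a copy of
  -- the finite `Σ'`. Taking the alternet of a chosen edge into `u` makes the numbering depend on
  -- `u` alone, so that indices of different in-neighbours can be compared.
  in-index : ∀ {u v} → E v u → Fin size
  in-index {u} {v} e = Inverse.to finite (SubIso.fun (in-alternet u) v (co-source e))

  in-index-injective : ∀ {u v v'} (e : E v u) (e' : E v' u) → in-index e ≡ in-index e' → v ≡ v'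
  in-index-injective {u} e e' eq =
    SubIso.inj (in-alternet u) _ _ (co-source e) (co-source e') (↔-injective finite eq)

  code : ∀ {u v} → UWalk D u v → List Letter
  code here      = []
  code (fwd e p) = inj₁ (Inverse.to (ov _) (_ , e)) ∷ code p
  code (bwd e p) = inj₂ (in-index e) ∷ code p

  -- Once the current vertex is known, a letter determines the next one, so a start and a word fix
  -- the end.
  code-end : ∀ {u v v'} (p : UWalk D u v) (q : UWalk D u v') → code p ≡ code q → v ≡ v'
  code-end here here _ = refl
  code-end (fwd {u} e p) (fwd e' q) eq
    with refl ← ↔-injective (ov u) (inj₁-injective (∷-injectiveˡ eq)) =
      code-end p q (∷-injectiveʳ eq)
  code-end (bwd e p) (bwd e' q) eq
    with refl ← in-index-injective e e' (inj₂-injective (∷-injectiveˡ eq)) =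
      code-end p q (∷-injectiveʳ eq)
  code-end here (fwd _ _) ()
  code-end here (bwd _ _) ()
  code-end (fwd _ _) here ()
  code-end (bwd _ _) here ()
  code-end (fwd _ _) (bwd _ _) eq = contradiction (∷-injectiveˡ eq) λ ()
  code-end (bwd _ _) (fwd _ _) eq = contradiction (∷-injectiveˡ eq) λ ()

  -- The walk from u to v is a function of (u , v), so equal vertices have equal codes.
  _≟_ : DecidableEquality V
  u ≟ v = map′ (code-end (connected u u) (connected u v)) (λ { refl → refl })
    (≡-dec (⊎-≡-dec _≟F_ _≟F_) (code (connected u u)) (code (connected u v)))

  -- Both out-neighbourhoods have `m` elements, so an inclusion between them is an equality.
  out-⊆⇒δ : ∀ {y k} → (∀ w → E y w → E k w) → δ D y k
  out-⊆⇒δ {y} {k} sub w = mk⇔ (sub w) back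
    where
    module Y = Inverse (ov y)
    module K = Inverse (ov k)

    shift : Fin m → Fin m
    shift i = K.to (proj₁ (Y.from i) , sub _ (proj₂ (Y.from i)))

    shift-inj : ∀ {i j} → shift i ≡ shift j → i ≡ j
    shift-inj eq = ↔-injective (↔-sym (ov y)) (Σ-≡ (cong proj₁ (↔-injective (ov k) eq)))
      where
      Σ-≡ : ∀ {p q : Σ V (E y)} → proj₁ p ≡ proj₁ q → p ≡ q
      Σ-≡ {_ , e} {_ , e'} refl = cong (_ ,_) (E-prop e e')

    back : E k w → E y w
    back e with finite-injective⇒onto (↔-id _) (λ _ → yes tt) (λ i _ → shift i) (λ _ _ → tt)
                  (λ _ _ _ _ → shift-inj) (K.to (w , e)) tt
    ... | i , _ , eq = subst (E y) (cong proj₁ (↔-injective (ov k) eq)) (proj₂ (Y.from i))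

  -- Automorphisms exchanging vertices with the same out-neighbours.

  module Exchange {y k z : V} (y~k : δ D y k) (y≢k : y ≢ k) (z≢y : z ≢ y) (z≢k : z ≢ k)
                  (ℓ-yz : ℓ y ≡ ℓ z) where

    X Y : List V
    X = y ∷ z ∷ []
    Y = k ∷ z ∷ []

    Below : V → V → ℕ → V → Set
    Below x x' n a = Path {D} n x a ⊎ Path {D} n x' a

    DescL⇒Below : ∀ {x x' a} → DescL D (x ∷ x' ∷ []) a → ∃[ n ] Below x x' n a
    DescL⇒Below (_ , hereₗ refl , d)          with n , p ← Desc⇒Path d = n , inj₁ p
    DescL⇒Below (_ , thereₗ (hereₗ refl) , d) with n , p ← Desc⇒Path d = n , inj₂ p

    Below⇒DescL : ∀ {x x' n a} → Below x x' n a → DescL D (x ∷ x' ∷ []) a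
    Below⇒DescL (inj₁ p) = _ , hereₗ refl , Path⇒Desc p
    Below⇒DescL (inj₂ p) = _ , thereₗ (hereₗ refl) , Path⇒Desc p

    ℓ-Below : ∀ {x x' n a} → ℓ x ≡ ℓ x' → Below x x' n a → ℓ a ≡ ℓ x' +ℤ + n
    ℓ-Below eq (inj₁ p) = trans (ℓ-Path p) (cong (_+ℤ _) eq)
    ℓ-Below eq (inj₂ p) = ℓ-Path p

    -- `y` and `k` have a common out-neighbour, hence the same level.
    ℓ-kz : ℓ k ≡ ℓ z
    ℓ-kz = trans (ℓ-coparents (Equivalence.to (y~k _) e) e) ℓ-yz
      where e = proj₂ (out-neighbour y)

    exchange : V → V
    exchange a with a ≟ y
    ... | yes _ = k
    ... | no  _ = a

    exchange-y : exchange y ≡ k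
    exchange-y with y ≟ y
    ... | yes _  = refl
    ... | no y≢y = contradiction refl y≢y

    exchange-z : exchange z ≡ z
    exchange-z with z ≟ y
    ... | yes eq = contradiction eq z≢y
    ... | no _   = refl

    -- The two descendant sets differ only at depth 0: a path of positive length from `y` becomes
    -- one from `k` by replacing its first edge.
    F : ℕ → V → V
    F zero    = exchange
    F (suc _) = λ a → a

    into : ∀ n {a} → Below y z n a → Below k z n (F n a)
    into zero    (inj₁ [])      = inj₁ (subst (Path 0 k) (sym exchange-y) [])
    into zero    (inj₂ [])      = inj₂ (subst (Path 0 z) (sym exchange-z) [])
    into (suc n) (inj₁ (e ∷ p)) = inj₁ (Equivalence.to (y~k _) e ∷ p)
    into (suc n) (inj₂ p)       = inj₂ p

    inj : ∀ n {a a'} → Below y z n a → Below y z n a' → F n a ≡ F n a' → a ≡ a'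
    inj zero (inj₁ []) (inj₁ []) _  = refl
    inj zero (inj₁ []) (inj₂ []) eq = contradiction (trans (sym exchange-z) (trans (sym eq) exchange-y)) z≢k
    inj zero (inj₂ []) (inj₁ []) eq = contradiction (trans (sym exchange-z) (trans eq exchange-y)) z≢k
    inj zero (inj₂ []) (inj₂ []) _  = refl
    inj (suc n) _ _ eq = eq

    surj : ∀ n {b} → Below k z n b → Σ V λ a → Below y z n a × F n a ≡ b
    surj zero    (inj₁ [])      = y , inj₁ [] , exchange-y
    surj zero    (inj₂ [])      = z , inj₂ [] , exchange-z
    surj (suc n) (inj₁ (e ∷ p)) = _ , inj₁ (Equivalence.from (y~k _) e ∷ p) , refl
    surj (suc n) (inj₂ p)       = _ , inj₂ p , refl

    edge : ∀ n {a a'} → Below y z n a → Below y z (suc n) a' → E a a' ⇔ E (F n a) (F (suc n) a')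
    edge zero {a' = a'} (inj₁ []) _ = subst (λ v → E y a' ⇔ E v a') (sym exchange-y) (y~k a')
    edge zero {a' = a'} (inj₂ []) _ = subst (λ v → E z a' ⇔ E v a') (sym exchange-z) (⇔-id _)
    edge (suc n) _ _ = ⇔-id _

    open GradedIso {DescL D X} {DescL D Y} {Below y z} {Below k z} {ℓ z} {ℓ z}
      DescL⇒Below Below⇒DescL DescL⇒Below Below⇒DescL (ℓ-Below ℓ-yz) (ℓ-Below ℓ-kz) F into inj surj edge
      using (iso; fun-at)

    automorphism : Σ (Aut D) λ g → (Aut.to g y ≡ k) × (Aut.to g z ≡ z)
    automorphism with proj₂ wdh X Y iso
    ... | g , agrees = g
        , trans (agrees y y∈X) (trans (fun-at (self-desc D X y y∈X) (inj₁ [])) exchange-y)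
        , trans (agrees z z∈X) (trans (fun-at (self-desc D X z z∈X) (inj₂ [])) exchange-z)
      where
      y∈X : y ∈ X
      y∈X = hereₗ refl
      z∈X : z ∈ X
      z∈X = thereₗ (hereₗ refl)

  -- The zigzag from `u` to `z`, back to `c` and on to `k`: a short witness that `k` is a sink of
  -- the alternet containing the edges out of `u`.
  record AlternetSink (u k : V) : Set where
    constructor sink
    field
      {c z} : V
      uz : E u z
      cz : E c z
      ck : E c k

  δ⇒AlternetSink : ∀ {u y k} → E u y → δ D y k → AlternetSink u k
  δ⇒AlternetSink {u} {y} {k} uy y~k with y ≟ k | other-out-neighbour uy
  ... | yes refl | _ = sink uy uy uy
  ... | no y≢k | z , uz , z≢y with z ≟ k
  ...   | yes refl = sink uz uz uz
  ...   | no z≢k with Exchange.automorphism y~k y≢k z≢y z≢k (ℓ-siblings uy uz)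
  -- The vertex `c` is the image of `u` under `g`: it has edges to the image `k` of `y` and to the
  -- fixed vertex `z`.
  ...     | g , gy , gz = sink uz (subst (E _) gz (E⇒E-to g uz)) (subst (E _) gy (E⇒E-to g uy))

  -- Counting the sinks of an alternet.

  module _ {u y : V} (uy : E u y) where
    private
      y⁺ : V
      y⁺ = proj₁ (out-neighbour y)
      yy⁺ : E y y⁺
      yy⁺ = proj₂ (out-neighbour y)
      -- Two alternets meet at `y`: it is a sink of the one described by `φ` and a source of the one
      -- described by `ψ`.
      module φ = SubIso (alt u y uy)
      module ψ = SubIso (alt y y⁺ yy⁺)

      y∈ψ : AlternetV D y y⁺ y
      y∈ψ = alternet-source yy⁺ yy⁺ yy⁺

      out∈ψ : ∀ {w} → E y w → AlternetV D y y⁺ w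
      out∈ψ yw = alternet-sink yy⁺ yy⁺ yy⁺ yw

      s : S.V
      s = ψ.fun y y∈ψ

      s-source : IsSource Σ' s
      s-source = _ , Equivalence.to (ψ.pres _ _ y∈ψ (out∈ψ yy⁺)) yy⁺

      module κ = PredBij (δ-classes s s-source)

      -- As an inclusion suffices, only the out-neighbours of `y` have to be located in the
      -- alternet.
      δ-pullback : ∀ {x} (q : AlternetV D y y⁺ x) → δ Σ' s (ψ.fun x q) → δ D y x
      δ-pullback q s~x = out-⊆⇒δ λ w yw → Equivalence.from (ψ.pres _ _ q (out∈ψ yw))
        (Equivalence.to (s~x _) (Equivalence.to (ψ.pres _ _ y∈ψ (out∈ψ yw)) yw))

      sink? : ∀ t → Dec (IsSink Σ' t)
      sink? t = [ (λ p → no (proj₂ p)) , (λ p → yes (proj₁ p)) ]′ (parts t)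

      -- Inverting `κ` and then `ψ` turns the equality of sizes in class C into an injection from
      -- the sinks of `Σ'` to the vertices with the same out-neighbours as `y`.
      twin : ∀ t → IsSink Σ' t → Σ V λ x → Σ (AlternetV D y y⁺ x) λ q →
             Σ _ λ p → κ.fun (ψ.fun x q) p ≡ t
      twin t t-sink with κ.surj t t-sink
      ... | s' , p , eq with ψ.surj s' tt
      ...   | x , q , refl = x , q , p , eq

      twin-δ : ∀ t p → δ D y (proj₁ (twin t p))
      twin-δ t p with twin t p
      ... | x , q , (_ , s~x) , _ = δ-pullback q s~x

      twin-inj : ∀ t t' p p' → proj₁ (twin t p) ≡ proj₁ (twin t' p') → t ≡ t'
      twin-inj t t' p p' eq with twin t p | twin t' p'
      twin-inj t t' p p' refl | x , q , r , eq | .x , q' , r' , eq' =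
        trans (sym eq) (trans (κ-irr (ψ.irr x q q') r r') eq')
        where
        κ-irr : ∀ {a a'} → a ≡ a' → ∀ r r' → κ.fun a r ≡ κ.fun a' r'
        κ-irr refl = κ.irr _

      module _ {k : V} (a : AlternetSink u k) where
        open AlternetSink a

        member : AlternetV D u y k
        member = alternet-sink uy uz cz ck

        index : S.V
        index = φ.fun k member

        index-sink : IsSink Σ' index
        index-sink = _ , Equivalence.to (φ.pres _ _ (alternet-source uy uz cz) member) ck

      -- The twin of a sink is itself a sink of the alternet below `u`, so `φ` sends it back to a
      -- sink of `Σ'`. This injective self-map of a finite set is onto, which forces every sink of
      -- that alternet to be a twin.
      θ : ∀ t → IsSink Σ' t → S.V
      θ t p = index (δ⇒AlternetSink uy (twin-δ t p))

      θ-onto : ∀ t → IsSink Σ' t → Σ S.V λ t' → Σ (IsSink Σ' t') λ p → θ t' p ≡ t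
      θ-onto = finite-injective⇒onto finite sink? θ (λ t p → index-sink (δ⇒AlternetSink uy (twin-δ t p)))
        (λ t t' p p' eq → twin-inj t t' p p' (φ.inj _ _ _ _ eq))

      θ-hits⇒δ : ∀ {k} (a : AlternetSink u k) →
                 (Σ S.V λ t → Σ (IsSink Σ' t) λ p → θ t p ≡ index a) → δ D y k
      θ-hits⇒δ a (t , p , eq) = subst (δ D y) (φ.inj _ _ _ _ eq) (twin-δ t p)

    out-neighbours-δ : ∀ {y'} → E u y' → δ D y y'
    out-neighbours-δ uy' = θ-hits⇒δ a (θ-onto (index a) (index-sink a))
      -- The degenerate zigzag `u y u y'`.
      where a = sink uy uy uy'

  -- The first inner vertex of the path has the same out-neighbours as `y`, so the path can be
  -- rerouted through `y`. Length at least 2 is essential, since a path of length 1 has no inner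
  -- vertex.
  Path-via : ∀ {x y n a} → E x y → Path {D} (suc (suc n)) x a → Path {D} (suc n) y a
  Path-via e (e' ∷ (e'' ∷ p)) = Equivalence.from (out-neighbours-δ e e' _) e'' ∷ p

  -- Extending the transitivity on arcs by one edge.

  module Extend (s : ℕ) (u w : ℕ → V)
    (u-edge : ∀ i → i < suc s → E (u i) (u (suc i)))
    (w-edge : ∀ i → i < suc s → E (w i) (w (suc i)))
    (g h : Aut D)
    (g-tail : ∀ i → i ≤ s → Aut.to g (u (suc i)) ≡ w (suc i))
    (h₀ : Aut.to h (u 0) ≡ w 0) (h₁ : Aut.to h (u 1) ≡ w 1) where

    -- Homogeneity controls the automorphism only on the chosen finite set, so the whole arc is
    -- taken; its descendants are still those of its first vertex.
    vertices : (ℕ → V) → List V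
    vertices v = applyUpTo v (suc (suc s))

    From : (ℕ → V) → ℕ → V → Set
    From v n = Path {D} n (v 0)

    prefix : ∀ (v : ℕ → V) → (∀ i → i < suc s → E (v i) (v (suc i))) → ∀ i → i ≤ suc s → From v i (v i)
    prefix v es i i≤ = walk⇒Path i _ (λ j j<i → es j (<-≤-trans j<i i≤))

    DescL⇒From : ∀ (v : ℕ → V) → (∀ i → i < suc s → E (v i) (v (suc i))) →
                 ∀ {a} → DescL D (vertices v) a → ∃[ n ] From v n a
    DescL⇒From v es (x , x∈ , d) with ∈-applyUpTo⁻ v x∈ | Desc⇒Path d
    ... | i , i< , refl | n , p = i +ℕ n , prefix v es i (s≤s⁻¹ i<) ++ p

    From⇒DescL : ∀ (v : ℕ → V) {n a} → From v n a → DescL D (vertices v) a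
    From⇒DescL v p = v 0 , hereₗ refl , Path⇒Desc p

    u₀u₁ : E (u 0) (u 1)
    u₀u₁ = u-edge 0 z<s
    w₀w₁ : E (w 0) (w 1)
    w₀w₁ = w-edge 0 z<s
    g₁ : Aut.to g (u 1) ≡ w 1
    g₁ = g-tail 0 z≤n

    -- Depth 1 needs `h`, since `g` need not send the other out-neighbours of `u 0` to
    -- out-neighbours of `w 0`. From depth 2 on, rerouting makes every vertex a descendant of `u 1`,
    -- which `g` sends to `w 1`.
    level-aut : ℕ → Aut D
    level-aut 0             = h
    level-aut 1             = h
    level-aut (suc (suc n)) = g

    F : ℕ → V → V
    F n = Aut.to (level-aut n)

    image-Path : ∀ (k : Aut D) {n x x' a} → Aut.to k x ≡ x' → Path {D} n x a → Path {D} n x' (Aut.to k a)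
    image-Path k refl = Path-map k

    preimage-Path : ∀ (k : Aut D) {n x x' b} → Aut.to k x ≡ x' → Path {D} n x' b →
                    Path {D} n x (Aut.from k b)
    preimage-Path k refl p = subst (λ v → Path _ v _) (Inverse.strictlyInverseʳ (Aut.bij k) _)
      (Path-map (Aut-inverse k) p)

    into : ∀ n {a} → From u n a → From w n (F n a)
    into 0             p = image-Path h h₀ p
    into 1             p = image-Path h h₀ p
    into (suc (suc n)) p = w₀w₁ ∷ image-Path g g₁ (Path-via u₀u₁ p)

    preimage : ∀ n {b} → From w n b → From u n (Aut.from (level-aut n) b)
    preimage 0             p = preimage-Path h h₀ p
    preimage 1             p = preimage-Path h h₀ p
    preimage (suc (suc n)) p = u₀u₁ ∷ preimage-Path g g₁ (Path-via w₀w₁ p)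

    δ-out : ∀ (v : ℕ → V) {a} → E (v 0) (v 1) → From v 1 a → δ D a (v 1)
    δ-out v e (e' ∷ []) = out-neighbours-δ e' e

    edge : ∀ n {a a'} → From u n a → From u (suc n) a' → E a a' ⇔ E (F n a) (F (suc n) a')
    edge 0             _ _ = Aut.pres h _ _
    -- Here the automorphism changes from `h` to `g`. Read from the last line up: replace the tail
    -- `a` by `u 1`, apply `g`, then replace `w 1` by the image of `a` under `h`.
    edge 1 {a} {a'}    p _ =
      δ-sym {D} (δ-out w w₀w₁ (into 1 p)) _
      ⇔-∘ (subst (λ v → E (u 1) a' ⇔ E v (Aut.to g a')) g₁ (Aut.pres g (u 1) a')
      ⇔-∘ δ-out u u₀u₁ p a')
    edge (suc (suc n)) _ _ = Aut.pres g _ _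

    open GradedIso {DescL D (vertices u)} {DescL D (vertices w)} {From u} {From w} {ℓ (u 0)} {ℓ (w 0)}
      (DescL⇒From u u-edge) (From⇒DescL u) (DescL⇒From w w-edge) (From⇒DescL w) ℓ-Path ℓ-Path F into
      (λ n _ _ → ↔-injective (Aut.bij (level-aut n)))
      (λ n {b} p → _ , preimage n p , Inverse.strictlyInverseˡ (Aut.bij (level-aut n)) b)
      edge
      using (iso; fun-at)

    F-arc : ∀ i → i ≤ suc s → F i (u i) ≡ w i
    F-arc 0             _  = h₀
    F-arc 1             _  = h₁
    F-arc (suc (suc i)) i≤ = g-tail (suc i) (s≤s⁻¹ i≤)

    automorphism : Σ (Aut D) λ k → ∀ i → i ≤ suc s → Aut.to k (u i) ≡ w i
    automorphism with proj₂ wdh (vertices u) (vertices w) iso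
    ... | k , agrees = k , λ i i≤ →
      let u∈ = ∈-applyUpTo⁺ u (s≤s i≤) in
      trans (agrees (u i) u∈)
        (trans (fun-at (self-desc D (vertices u) (u i) u∈) (prefix u u-edge i i≤)) (F-arc i i≤))

  -- Induction on the length of arcs.

  highly-arc-transitive : HighlyArcTransitive D
  highly-arc-transitive zero u w _ _ with proj₁ wdh (u 0) (w 0)
  ... | g , eq = g , λ { zero _ → eq }
  highly-arc-transitive (suc s) u w (u-edge , u-nr) (w-edge , w-nr)
    with et (u 0) (u 1) (w 0) (w 1) (u-edge 0 z<s) (w-edge 0 z<s)
       | highly-arc-transitive s (u ∘ suc) (w ∘ suc)
           ((λ i i< → u-edge (suc i) (s≤s i<)) , (λ i i< → u-nr (suc i) (s≤s i<)))
           ((λ i i< → w-edge (suc i) (s≤s i<)) , (λ i i< → w-nr (suc i) (s≤s i<)))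
  ... | h , h₀ , h₁ | g , g-tail = Extend.automorphism s u w u-edge w-edge g h g-tail h₀ h₁

theorem5p11 : (D : Digraph) (m : ℕ) (Σ' : Digraph) → Infinite D → Connected D → EdgeTransitive D → WeaklyDescendantHomogeneous D → OutValency D m → 1 < m → PropertyZ D → InClassC Σ' → (∀ a b → Digraph.E D a b → SubIso D (AlternetV D a b) Σ' (λ _ → ⊤)) → HighlyArcTransitive D
theorem5p11 D m Σ' _ conn et wdh ov 1<m pz inC alt =
  highly-arc-transitive D m Σ' conn et wdh ov 1<m pz inC alt
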